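{- Let $s\ge0$ be an integer and let $\phi$ be a CNF formula on $n$ variables with at most $2^s$ clauses. Then the number of isolated solutions of $\phi$ is at most $2^{\,n-n/(s+2)+1}$.
   Context: A CNF formula is an AND of clauses (ORs of literals). An assignment $x\in\{0,1\}^n$ is an isolated solution of $\phi$ if $\phi(x)=1$ and $\phi(y)=0$ for every $y\in\{0,1\}^n$ differing from $x$ in exactly one coordinate. -}

module Defs where

open import Data.Bool using (Bool; true; false; _∧_; _∨_; if_then_else_; not)
open import Data.Bool.Properties using () renaming (_≟_ to _≟ᵇ_)
open import Data.Nat using (ℕ; zero; suc)
open import Data.Fin using (Fin)
open import Data.Vec using (Vec; []; _∷_; lookup; updateAt)
open import Data.List using (List; []; _∷_; map; _++_; filter; length)
open import Data.Bool.ListAction using (all; any)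
open import Data.Product using (_×_; _,_)
open import Relation.Binary.PropositionalEquality using (_≡_)
open import Relation.Nullary using (Dec; yes; no)
open import Relation.Nullary.Decidable using (_×-dec_)
open import Data.Fin.Properties using (all?)

-- A literal over variables x_0..x_{n-1}: (i , true) is x_i, (i , false) is ¬x_i.
Literal : ℕ → Set
Literal n = Fin n × Bool

Clause : ℕ → Set
Clause n = List (Literal n)

CNF : ℕ → Set
CNF n = List (Clause n)

Assignment : ℕ → Set
Assignment n = Vec Bool n

evalLit : ∀ {n} → Assignment n → Literal n → Bool
evalLit x (i , true)  = lookup x i
evalLit x (i , false) = not (lookup x i)

evalClause : ∀ {n} → Assignment n → Clause n → Bool
evalClause x c = any (evalLit x) c

evalCNF : ∀ {n} → CNF n → Assignment n → Bool
evalCNF φ x = all (evalClause x) φ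

-- flip coordinate i: the assignments differing from x in exactly one coordinate
-- are exactly flip x i for i : Fin n.
flip : ∀ {n} → Assignment n → Fin n → Assignment n
flip x i = updateAt x i not

IsolatedSolution : ∀ {n} → CNF n → Assignment n → Set
IsolatedSolution φ x = (evalCNF φ x ≡ true) × (∀ i → evalCNF φ (flip x i) ≡ false)

isolated? : ∀ {n} (φ : CNF n) (x : Assignment n) → Dec (IsolatedSolution φ x)
isolated? φ x = (evalCNF φ x ≟ᵇ true) ×-dec all? (λ i → evalCNF φ (flip x i) ≟ᵇ false)

allAssignments : ∀ n → List (Assignment n)
allAssignments zero = [] ∷ []
allAssignments (suc n) = map (true ∷_) (allAssignments n) ++ map (false ∷_) (allAssignments n)

numIsolated : ∀ {n} → CNF n → ℕ
numIsolated {n} φ = length (filter (isolated? φ) (allAssignments n))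

{-# OPTIONS --safe #-}

-- Put k = s + 2 and generalise to a set S of solutions that agree outside a list
-- L of variables and are isolated in every direction of L, with claimed bound
-- |S| ≤ 2 · 2^(|L| - |L|/k).  For each clause fix a window: k of its variables
-- in L, or all of them if there are fewer.
--
-- If a solution falsifies the k windowed variables of some clause, then these
-- variables are fixed, and induction applies to the remaining |L| - k.  There are
-- at most 2^s clauses, so this contributes at most half of the claimed bound.
--
-- Every other solution satisfies the window of each clause, so that clauses may be
-- treated as having width at most k, and the satisfiability coding lemma of
-- Paturi, Pudlák and Zane applies: the value of x at i is determined by the at most
-- k - 1 other variables in the window of a clause critical for x at i.  In a
-- random order of L these precede i with probability at least 1/k, so x has a code
-- of average length |L| - |L|/k.  Kraft's inequality and the convexity of 2^t bound
-- the number of such solutions by the other half.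
--
-- Real exponents are avoided by raising all inequalities to the k-th power.
module Submission where

open import Defs
open import Data.Bool using (Bool; true; false; not; if_then_else_) renaming (_≟_ to _≟ᵇ_)
open import Data.Bool.ListAction using (any; all)
open import Data.Bool.Properties using (not-injective)
open import Data.Fin using (Fin)
open import Data.Fin.Properties using () renaming (_≟_ to _≟ᶠ_)
open import Data.List using (List; []; _∷_; map; _++_; filter; length; concatMap; take; allFin)
import Data.List.Membership.DecPropositional as DecMembership
open import Data.List.Membership.Propositional using (_∈_; _∉_; lose; find)
open import Data.List.Membership.Propositional.Properties using (∈-filter⁺; ∈-filter⁻; ∈-map⁺; ∈-map⁻; ∈-allFin)
open import Data.List.Properties using (map-++; map-∘; filter-all; filter-none; filter-notAll; filter-some; length-take; take-all; length-tabulate)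
import Data.List.Relation.Binary.Sublist.Propositional as Sublist
import Data.List.Relation.Binary.Sublist.Propositional.Properties as Sublist
open import Data.List.Relation.Unary.All using (All; []; _∷_)
import Data.List.Relation.Unary.All as All
import Data.List.Relation.Unary.All.Properties as All
open import Data.List.Relation.Unary.AllPairs using ([]; _∷_)
open import Data.List.Relation.Unary.Any using (Any; here; there; any?)
open import Data.List.Relation.Unary.Unique.Propositional using (Unique)
import Data.List.Relation.Unary.Unique.Propositional.Properties as Unique
open import Data.Nat using (ℕ; zero; suc; _+_; _*_; _^_; _/_; _%_; _!; _≤_; _<_; _≟_; _≤?_; z≤n; s≤s; NonZero; >-nonZero; >-nonZero⁻¹)
open import Data.Nat.DivMod using (m≡m%n+[m/n]*n; m%n<n)
open import Data.Nat.ListAction using (sum)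
open import Data.Nat.ListAction.Properties using (sum-++)
open import Data.Nat.Properties hiding (_≟_; _≤?_)
open import Data.Nat.Tactic.RingSolver using (solve-∀)
open import Data.Product using (_×_; _,_; proj₁; proj₂; ∃)
open import Data.Sum using (inj₁; inj₂; [_,_]′)
open import Data.Vec using ([]; _∷_; lookup)
open import Data.Vec.Properties using (tabulate∘lookup; tabulate-cong; lookup∘updateAt; lookup∘updateAt′; ∷-injectiveʳ)
open import Function using (_∘_)
open import Level using (0ℓ)
open import Relation.Binary using (DecidableEquality)
open import Relation.Binary.PropositionalEquality using (_≡_; _≢_; refl; sym; trans; cong; cong₂; subst; ≢-sym; module ≡-Reasoning)
open import Relation.Nullary using (¬_; yes; no; contradiction)
open import Relation.Nullary.Decidable using (¬?; _×-dec_; _→-dec_)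
open import Relation.Unary using (Pred; Decidable)

-- Powers

^-distribʳ-* : ∀ m n o → (m * n) ^ o ≡ m ^ o * n ^ o
^-distribʳ-* m n zero    = refl
^-distribʳ-* m n (suc o) =
  trans (cong (m * n *_) (^-distribʳ-* m n o)) ([m*n]*[o*p]≡[m*o]*[n*p] m n (m ^ o) (n ^ o))

-- The growth factor `(1 + 1 / a) ^ k` falls as `a` grows: this is `a * suc b ≤ suc a * b` raised to
-- the power `k`.
growth-antitone : ∀ k {a b} .{{_ : NonZero b}} → a ≤ b →
                  2 * b ^ k ≤ suc b ^ k → 2 * a ^ k ≤ suc a ^ k
growth-antitone k {a} {b} a≤b h = *-cancelʳ-≤ _ _ (b ^ k) {{m^n≢0 b k}} (begin
  2 * a ^ k * b ^ k    ≡⟨ rearrange (a ^ k) (b ^ k) ⟩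
  a ^ k * (2 * b ^ k)  ≤⟨ *-monoʳ-≤ (a ^ k) h ⟩
  a ^ k * suc b ^ k    ≡⟨ ^-distribʳ-* a (suc b) k ⟨
  (a * suc b) ^ k      ≤⟨ ^-monoˡ-≤ k (≤-trans (≤-reflexive (*-suc a b)) (+-monoˡ-≤ (a * b) a≤b)) ⟩
  (suc a * b) ^ k      ≡⟨ ^-distribʳ-* (suc a) b k ⟩
  suc a ^ k * b ^ k    ∎)
  where
  open ≤-Reasoning
  rearrange : ∀ x y → 2 * x * y ≡ x * (2 * y)
  rearrange = solve-∀

-- The ratio of consecutive values of (k + r) ^ k decreases with r, so
-- (k + r) ^ k / 2 ^ r first increases and then decreases; its values at
-- r = 0 and r = k are both k ^ k.
module _ (k : ℕ) .{{_ : NonZero k}} where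

  private
    instance
      k+r≢0 : ∀ {r} → NonZero (k + r)
      k+r≢0 {r} = >-nonZero (≤-trans (>-nonZero⁻¹ k) (m≤m+n k r))

    Bound : ℕ → Set
    Bound r = 2 ^ r * k ^ k ≤ (k + r) ^ k

    increasing : ∀ r → 2 * (k + r) ^ k ≤ suc (k + r) ^ k → Bound r
    increasing zero    _ = ≤-reflexive (trans (*-identityˡ _) (cong (_^ k) (sym (+-identityʳ k))))
    increasing (suc r) h = begin
      2 * 2 ^ r * k ^ k    ≡⟨ *-assoc 2 (2 ^ r) (k ^ k) ⟩
      2 * (2 ^ r * k ^ k)  ≤⟨ *-monoʳ-≤ 2 (increasing r h′) ⟩
      2 * (k + r) ^ k      ≤⟨ h′ ⟩
      suc (k + r) ^ k      ≡⟨ cong (_^ k) (+-suc k r) ⟨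
      (k + suc r) ^ k      ∎
      where
      open ≤-Reasoning
      h′ = growth-antitone k (+-monoʳ-≤ k (n≤1+n r)) h

    -- If the ratio at `r` is at least 2, then so are all earlier ratios, and `increasing` climbs
    -- from the equality at 0. Otherwise the bound at `r + 1` implies the one at `r`, and this chain
    -- ends with the equality at `r = k`.
    decreasing : ∀ d r → d + r ≡ k → Bound r
    decreasing zero    r refl = ≤-reflexive
      (trans (sym (^-distribʳ-* 2 k k)) (cong (λ m → (k + m) ^ k) (+-identityʳ k)))
    decreasing (suc d) r eq with 2 * (k + r) ^ k ≤? suc (k + r) ^ k
    ... | yes h = increasing r h
    ... | no ¬h = *-cancelˡ-≤ 2 (begin
      2 * (2 ^ r * k ^ k)  ≡⟨ *-assoc 2 (2 ^ r) (k ^ k) ⟨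
      2 ^ suc r * k ^ k    ≤⟨ decreasing d (suc r) (trans (+-suc d r) eq) ⟩
      (k + suc r) ^ k      ≡⟨ cong (_^ k) (+-suc k r) ⟩
      suc (k + r) ^ k      ≤⟨ <⇒≤ (≰⇒> ¬h) ⟩
      2 * (k + r) ^ k      ∎)
      where open ≤-Reasoning

  2^r*k^k≤[k+r]^k : ∀ {r} → r ≤ k → 2 ^ r * k ^ k ≤ (k + r) ^ k
  2^r*k^k≤[k+r]^k {r} r≤k = decreasing _ r (m∸n+n≡m r≤k)

-- The chord of 2 ^ t over [q , q + 1] lies below 2 ^ t at every integer t.
chord : ∀ q t → 2 ^ q * suc t ≤ 2 ^ t + q * 2 ^ q
chord zero    t       = begin
  1 * suc t  ≡⟨ *-identityˡ (suc t) ⟩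
  suc t      ≤⟨ go t ⟩
  2 ^ t      ≡⟨ +-identityʳ _ ⟨
  2 ^ t + 0  ∎
  where
  open ≤-Reasoning
  go : ∀ t → suc t ≤ 2 ^ t
  go zero    = ≤-refl
  go (suc t) = begin
    suc (suc t)    ≤⟨ +-mono-≤ (m^n>0 2 t) (go t) ⟩
    2 ^ t + 2 ^ t  ≡⟨ cong (2 ^ t +_) (+-identityʳ _) ⟨
    2 ^ suc t      ∎
chord (suc q) zero    = begin
  2 * 2 ^ q * 1               ≡⟨ *-identityʳ _ ⟩
  2 * 2 ^ q                   ≤⟨ m≤m+n _ _ ⟩
  2 * 2 ^ q + q * (2 * 2 ^ q) ≤⟨ n≤1+n _ ⟩
  1 + suc q * (2 * 2 ^ q)     ∎
  where open ≤-Reasoning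
-- The chord is `2 ^ q * (1 + t - q)`. It doubles when `q` and `t` both grow by one, as does
-- `2 ^ t`.
chord (suc q) (suc t) = begin
  2 * 2 ^ q * suc (suc t)                  ≡⟨ lhs (2 ^ q) t ⟩
  2 * (2 ^ q * suc t) + 2 * 2 ^ q          ≤⟨ +-monoˡ-≤ _ (*-monoʳ-≤ 2 (chord q t)) ⟩
  2 * (2 ^ t + q * 2 ^ q) + 2 * 2 ^ q      ≡⟨ rhs (2 ^ t) q (2 ^ q) ⟩
  2 * 2 ^ t + suc q * (2 * 2 ^ q)          ∎
  where
  open ≤-Reasoning
  lhs : ∀ a t → 2 * a * suc (suc t) ≡ 2 * (a * suc t) + 2 * a
  lhs = solve-∀
  rhs : ∀ b q a → 2 * (b + q * a) + 2 * a ≡ 2 * b + suc q * (2 * a)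
  rhs = solve-∀

-- Sums over lists

∑ : ∀ {a} {A : Set a} → List A → (A → ℕ) → ℕ
∑ xs f = sum (map f xs)

module _ {a} {A : Set a} where

  ∑-mono : ∀ {f g : A → ℕ} xs → (∀ {x} → x ∈ xs → f x ≤ g x) → ∑ xs f ≤ ∑ xs g
  ∑-mono []       h = z≤n
  ∑-mono (x ∷ xs) h = +-mono-≤ (h (here refl)) (∑-mono xs (h ∘ there))

  ∑-cong : ∀ {f g : A → ℕ} xs → (∀ {x} → x ∈ xs → f x ≡ g x) → ∑ xs f ≡ ∑ xs g
  ∑-cong []       h = refl
  ∑-cong (x ∷ xs) h = cong₂ _+_ (h (here refl)) (∑-cong xs (h ∘ there))

  ∈⇒≤∑ : ∀ {f : A → ℕ} {x xs} → x ∈ xs → f x ≤ ∑ xs f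
  ∈⇒≤∑ (here refl)           = m≤m+n _ _
  ∈⇒≤∑ {f} {xs = y ∷ _} (there x∈xs) = ≤-trans (∈⇒≤∑ x∈xs) (m≤n+m _ (f y))

  ∑-const : ∀ (xs : List A) c → ∑ xs (λ _ → c) ≡ length xs * c
  ∑-const []       c = refl
  ∑-const (x ∷ xs) c = cong (c +_) (∑-const xs c)

  ∑-+ : ∀ (xs : List A) (f g : A → ℕ) → ∑ xs (λ x → f x + g x) ≡ ∑ xs f + ∑ xs g
  ∑-+ []       f g = refl
  ∑-+ (x ∷ xs) f g = trans (cong (f x + g x +_) (∑-+ xs f g)) (rearrange (f x) (g x) (∑ xs f) (∑ xs g))
    where
    rearrange : ∀ m n o p → m + n + (o + p) ≡ m + o + (n + p)
    rearrange = solve-∀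

  ∑-* : ∀ (xs : List A) c (f : A → ℕ) → ∑ xs (λ x → c * f x) ≡ c * ∑ xs f
  ∑-* []       c f = sym (*-zeroʳ c)
  ∑-* (x ∷ xs) c f = trans (cong (c * f x +_) (∑-* xs c f)) (sym (*-distribˡ-+ c (f x) (∑ xs f)))

  ∑-++ : ∀ xs ys (f : A → ℕ) → ∑ (xs ++ ys) f ≡ ∑ xs f + ∑ ys f
  ∑-++ xs ys f = trans (cong sum (map-++ f xs ys)) (sum-++ (map f xs) (map f ys))

module _ {a b} {A : Set a} {B : Set b} where

  ∑-map : ∀ (h : A → B) xs (f : B → ℕ) → ∑ (map h xs) f ≡ ∑ xs (f ∘ h)
  ∑-map h xs f = cong sum (sym (map-∘ xs))

  ∑-concatMap : ∀ (h : A → List B) xs (f : B → ℕ) → ∑ (concatMap h xs) f ≡ ∑ xs (λ x → ∑ (h x) f)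
  ∑-concatMap h []       f = refl
  ∑-concatMap h (x ∷ xs) f =
    trans (∑-++ (h x) (concatMap h xs) f) (cong (∑ (h x) f +_) (∑-concatMap h xs f))

  ∑-swap : ∀ (xs : List A) (ys : List B) (f : A → B → ℕ) →
           ∑ xs (λ x → ∑ ys (f x)) ≡ ∑ ys (λ y → ∑ xs (λ x → f x y))
  ∑-swap []       ys f = sym (trans (∑-const ys 0) (*-zeroʳ (length ys)))
  ∑-swap (x ∷ xs) ys f = trans (cong (∑ ys (f x) +_) (∑-swap xs ys f)) (sym (∑-+ ys (f x) _))

module _ {a p} {A : Set a} {P : Pred A p} (P? : Decidable P) where

  ∑-filter-split : ∀ xs (f : A → ℕ) → ∑ xs f ≡ ∑ (filter P? xs) f + ∑ (filter (¬? ∘ P?) xs) f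
  ∑-filter-split []       f = refl
  ∑-filter-split (x ∷ xs) f with P? x
  ... | yes _ = trans (cong (f x +_) (∑-filter-split xs f)) (sym (+-assoc (f x) _ _))
  ... | no _  = trans (cong (f x +_) (∑-filter-split xs f)) (rearrange (f x) (∑ (filter P? xs) f) _)
    where
    rearrange : ∀ m n o → m + (n + o) ≡ n + (m + o)
    rearrange = solve-∀

  length-filter-split : ∀ xs → length (filter P? xs) + length (filter (¬? ∘ P?) xs) ≡ length xs
  length-filter-split []       = refl
  length-filter-split (x ∷ xs) with P? x
  ... | yes _ = cong suc (length-filter-split xs)
  ... | no _  = trans (+-suc _ _) (cong suc (length-filter-split xs))

  -- Filtering a one-element list acts as an indicator of `P`; the restriction moves inside the sum,
  -- where `∑-swap` can be used.
  ∑-filter : ∀ xs (f : A → ℕ) → ∑ (filter P? xs) f ≡ ∑ xs (λ x → ∑ (filter P? (x ∷ [])) f)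
  ∑-filter []       f = refl
  ∑-filter (x ∷ xs) f with P? x
  ... | yes _ = cong₂ _+_ (sym (+-identityʳ (f x))) (∑-filter xs f)
  ... | no _  = ∑-filter xs f

  length-filter-∑ : ∀ xs → length (filter P? xs) ≡ ∑ xs (λ x → length (filter P? (x ∷ [])))
  length-filter-∑ []       = refl
  length-filter-∑ (x ∷ xs) with P? x
  ... | yes _ = cong suc (length-filter-∑ xs)
  ... | no _  = length-filter-∑ xs

  length≤∑ : ∀ {xs} {f : A → ℕ} → (∀ {x} → x ∈ xs → P x → 1 ≤ f x) → length (filter P? xs) ≤ ∑ xs f
  length≤∑ {[]}     h = z≤n
  length≤∑ {x ∷ xs} h with P? x
  ... | yes p = +-mono-≤ (h (here refl) p) (length≤∑ (h ∘ there))
  ... | no _  = ≤-trans (length≤∑ (h ∘ there)) (m≤n+m _ _)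

module _ {a b p} {A : Set a} {B : Set b} {R : B → Pred A p} (R? : ∀ y → Decidable (R y)) where

  union-bound : ∀ xs ys → length (filter (λ x → any? (λ y → R? y x) ys) xs) ≤
                          ∑ ys (λ y → length (filter (R? y) xs))
  union-bound xs ys = begin
    length (filter (λ x → any? (λ y → R? y x) ys) xs)       ≤⟨ length≤∑ (λ x → any? (λ y → R? y x) ys) {xs} each ⟩
    ∑ xs (λ x → ∑ ys (λ y → length (filter (R? y) (x ∷ [])))) ≡⟨ ∑-swap xs ys _ ⟩
    ∑ ys (λ y → ∑ xs (λ x → length (filter (R? y) (x ∷ [])))) ≡⟨ ∑-cong ys (λ {y} _ → length-filter-∑ (R? y) xs) ⟨
    ∑ ys (λ y → length (filter (R? y) xs))                  ∎
    where
    open ≤-Reasoning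
    each : ∀ {x} → x ∈ xs → Any (λ y → R y x) ys → 1 ≤ ∑ ys (λ y → length (filter (R? y) (x ∷ [])))
    each _ some with y , y∈ys , r ← find some = ≤-trans (filter-some (R? y) (here r)) (∈⇒≤∑ y∈ys)

-- Removing an element from a list

module Removal {a} {A : Set a} (_≟_ : DecidableEquality A) where

  infixl 6 _\\_
  _\\_ : List A → A → List A
  xs \\ x = filter (λ y → ¬? (y ≟ x)) xs

  ∈-\\⁺ : ∀ {x y xs} → y ∈ xs → y ≢ x → y ∈ xs \\ x
  ∈-\\⁺ {x} = ∈-filter⁺ (λ y → ¬? (y ≟ x))

  ∈-\\⁻ : ∀ {x y} xs → y ∈ xs \\ x → y ∈ xs × y ≢ x
  ∈-\\⁻ {x} xs = ∈-filter⁻ (λ y → ¬? (y ≟ x)) {xs = xs}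

  length-\\-< : ∀ {x xs} → x ∈ xs → length (xs \\ x) < length xs
  length-\\-< {x} x∈xs = filter-notAll (λ y → ¬? (y ≟ x)) _ (lose x∈xs (λ x≢x → x≢x refl))

  \\-∉ : ∀ {x} xs → x ∉ xs → xs \\ x ≡ xs
  \\-∉     []       _    = refl
  \\-∉ {x} (y ∷ xs) x∉xs with y ≟ x
  ... | yes refl = contradiction (here refl) x∉xs
  ... | no _     = cong (y ∷_) (\\-∉ xs (x∉xs ∘ there))

  length-\\ : ∀ {x xs} → Unique xs → x ∈ xs → suc (length (xs \\ x)) ≡ length xs
  length-\\ {x} {y ∷ xs} (y∉xs ∷ !xs) x∈ with y ≟ x
  ... | yes refl = cong suc (cong length (\\-∉ xs (All.All¬⇒¬Any y∉xs)))
  length-\\ {x} {y ∷ xs} (y∉xs ∷ !xs) (here refl) | no y≢x = contradiction refl y≢x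
  length-\\ {x} {y ∷ xs} (y∉xs ∷ !xs) (there x∈) | no y≢x = cong suc (length-\\ !xs x∈)

  filter-\\-comm : ∀ {p} {P : Pred A p} (P? : Decidable P) x xs → filter P? (xs \\ x) ≡ filter P? xs \\ x
  filter-\\-comm P? x [] = refl
  filter-\\-comm P? x (y ∷ xs) with y ≟ x in eq | P? y in eq′
  ... | yes _ | yes _ rewrite eq = filter-\\-comm P? x xs
  ... | yes _ | no _  = filter-\\-comm P? x xs
  ... | no _  | yes _ rewrite eq | eq′ = cong (y ∷_) (filter-\\-comm P? x xs)
  ... | no _  | no _  rewrite eq′ = filter-\\-comm P? x xs

  -- Both sides run over the ordered pairs of entries with different values, and being different is
  -- symmetric.
  ∑∑-\\-swap : ∀ xs (f : A → A → ℕ) →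
               ∑ xs (λ x → ∑ (xs \\ x) (f x)) ≡ ∑ xs (λ y → ∑ (xs \\ y) (λ x → f x y))
  ∑∑-\\-swap xs f = begin
    ∑ xs (λ x → ∑ (xs \\ x) (f x))                                    ≡⟨ ∑-cong xs (λ {x} _ → ∑-filter (λ z → ¬? (z ≟ _)) xs (f x)) ⟩
    ∑ xs (λ x → ∑ xs (λ y → ∑ ((y ∷ []) \\ x) (f x)))                 ≡⟨ ∑-swap xs xs _ ⟩
    ∑ xs (λ y → ∑ xs (λ x → ∑ ((y ∷ []) \\ x) (f x)))                 ≡⟨ ∑-cong xs (λ {y} _ → ∑-cong xs (λ {x} _ → flip-one x y)) ⟩
    ∑ xs (λ y → ∑ xs (λ x → ∑ ((x ∷ []) \\ y) (λ x → f x y)))         ≡⟨ ∑-cong xs (λ {y} _ → ∑-filter (λ z → ¬? (z ≟ _)) xs (λ x → f x y)) ⟨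
    ∑ xs (λ y → ∑ (xs \\ y) (λ x → f x y))                            ∎
    where
    open ≡-Reasoning
    flip-one : ∀ x y → ∑ ((y ∷ []) \\ x) (f x) ≡ ∑ ((x ∷ []) \\ y) (λ x → f x y)
    flip-one x y with y ≟ x | x ≟ y
    ... | yes _    | yes _    = refl
    ... | yes refl | no x≢x   = contradiction refl x≢x
    ... | no x≢x   | yes refl = contradiction refl x≢x
    ... | no _     | no _     = refl

  Unique-⊆⇒length-≤ : ∀ {xs ys : List A} → Unique xs → (∀ {x} → x ∈ xs → x ∈ ys) → length xs ≤ length ys
  Unique-⊆⇒length-≤ []                      _  = z≤n
  Unique-⊆⇒length-≤ {x ∷ xs} {ys} (x∉ ∷ !xs) xs⊆ys = ≤-trans
    (s≤s (Unique-⊆⇒length-≤ !xs (λ z∈xs → ∈-\\⁺ (xs⊆ys (there z∈xs)) (λ { refl → All.All¬⇒¬Any x∉ z∈xs }))))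
    (length-\\-< (xs⊆ys (here refl)))

-- The satisfiability coding lemma

module _ {n : ℕ} where
  open Removal (_≟ᶠ_ {n})
  open DecMembership (_≟ᶠ_ {n}) using (_∈?_)

  Variables : Set
  Variables = List (Fin n)

  -- In the code, `L` holds the variables not yet listed, so `meet V L ≡ 0` means that nothing of
  -- `V` is still to come.
  meet : Variables → Variables → ℕ
  meet V L = length (filter (_∈? V) L)

  meet≡0⇒∉ : ∀ {V L j} → meet V L ≡ 0 → j ∈ V → j ∉ L
  meet≡0⇒∉ {V} {L} v≡0 j∈V j∈L with filter (_∈? V) L | ∈-filter⁺ (_∈? V) j∈L j∈V
  ... | _ ∷ _ | _ with () ← v≡0

  meet-\\-∈ : ∀ {V L i} → Unique L → i ∈ L → i ∈ V → suc (meet V (L \\ i)) ≡ meet V L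
  meet-\\-∈ {V} {L} {i} !L i∈L i∈V =
    trans (cong (suc ∘ length) (filter-\\-comm (_∈? V) i L))
          (length-\\ (Unique.filter⁺ (_∈? V) !L) (∈-filter⁺ (_∈? V) i∈L i∈V))

  meet-\\-∉ : ∀ {V} L {i} → i ∉ V → meet V (L \\ i) ≡ meet V L
  meet-\\-∉ {V} L {i} i∉V =
    trans (cong length (filter-\\-comm (_∈? V) i L))
          (cong length (\\-∉ (filter (_∈? V) L) (i∉V ∘ proj₂ ∘ ∈-filter⁻ (_∈? V) {xs = L})))

  -- Random orders and forced variables

  δ : ℕ → ℕ
  δ zero    = 1
  δ (suc _) = 0

  -- The number `f` stands for the length of `L` and makes the recursion structural.
  orders : ℕ → Variables → List Variables
  orders zero    L = [] ∷ []
  orders (suc f) L = concatMap (λ i → map (i ∷_) (orders f (L \\ i))) L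

  data Order : Variables → Variables → Set where
    []   : Order [] []
    step : ∀ {L i π} → i ∈ L → Order (L \\ i) π → Order L (i ∷ π)

  ∑-orders : ∀ f L (g : Variables → ℕ) →
             ∑ (orders (suc f) L) g ≡ ∑ L (λ i → ∑ (orders f (L \\ i)) (g ∘ (i ∷_)))
  ∑-orders f L g = trans (∑-concatMap _ L g) (∑-cong L (λ {i} _ → ∑-map (i ∷_) (orders f (L \\ i)) g))

  unique-\\ : ∀ {L i} → Unique L → Unique (L \\ i)
  unique-\\ = Unique.filter⁺ _

  length-\\≡ : ∀ {L i f} → Unique L → length L ≡ suc f → i ∈ L → length (L \\ i) ≡ f
  length-\\≡ !L eq i∈L = suc-injective (trans (length-\\ !L i∈L) eq)

  orders-sound : ∀ f {L} → Unique L → length L ≡ f →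
                 All (λ π → Order L π × length π ≡ f) (orders f L)
  orders-sound zero    {[]} !L eq = ([] , refl) ∷ []
  orders-sound (suc f) {L} !L eq = All.concat⁺ (All.map⁺ (All.tabulate (λ i∈L →
    All.map⁺ (All.map (λ (o , l) → step i∈L o , cong suc l)
                      (orders-sound f (unique-\\ !L) (length-\\≡ !L eq i∈L))))))

  ∑-orders-const : ∀ f {L} c → Unique L → length L ≡ f → ∑ (orders f L) (λ _ → c) ≡ f ! * c
  ∑-orders-const zero    c !L eq = refl
  ∑-orders-const (suc f) {L} c !L eq = begin
    ∑ (orders (suc f) L) (λ _ → c)               ≡⟨ ∑-orders f L _ ⟩
    ∑ L (λ i → ∑ (orders f (L \\ i)) (λ _ → c))  ≡⟨ ∑-cong L (λ i∈L → ∑-orders-const f c (unique-\\ !L) (length-\\≡ !L eq i∈L)) ⟩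
    ∑ L (λ _ → f ! * c)                          ≡⟨ ∑-const L _ ⟩
    length L * (f ! * c)                         ≡⟨ cong (_* (f ! * c)) eq ⟩
    suc f * (f ! * c)                            ≡⟨ *-assoc (suc f) (f !) c ⟨
    (suc f) ! * c                                ∎
    where open ≡-Reasoning

  -- The number of orders of L, of length f, in which j comes after all of V ∩ L.
  lastCount : Fin n → Variables → ℕ → Variables → ℕ
  lastCount j V zero    L = 0
  -- If `j` comes first, the order counts only when nothing of `V` is left, and the rest has `f !`
  -- orders. If another `i` comes first, the count goes on without `i`.
  lastCount j V (suc f) L = f ! * δ (meet V L) + ∑ (L \\ j) (λ i → lastCount j V f (L \\ i))

  -- By symmetry `j` comes last among itself and the variables of `V` in `L` in one order out of
  -- `suc (meet V L)`. Induction over the first variable of the order replaces the symmetry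
  -- argument.
  lastCount-≥ : ∀ {j V} f {L} → j ∉ V → Unique L → length L ≡ f → j ∈ L →
                f ! ≤ suc (meet V L) * lastCount j V f L
  lastCount-≥ zero    {[]} j∉V !L eq ()
  lastCount-≥ {j} {V} (suc f) {L} j∉V !L eq j∈L with meet V L in v≡
  ... | zero = begin
    f ! + f * f !                                                   ≡⟨ cong₂ _+_ (sym (*-identityʳ (f !))) (cong (_* f !) (sym L\j≡f)) ⟩
    f ! * 1 + length (L \\ j) * f !                                 ≡⟨ cong (f ! * 1 +_) (∑-const (L \\ j) (f !)) ⟨
    f ! * 1 + ∑ (L \\ j) (λ _ → f !)                                ≤⟨ +-monoʳ-≤ (f ! * 1) (∑-mono (L \\ j) each) ⟩
    f ! * 1 + ∑ (L \\ j) (λ i → lastCount j V f (L \\ i))           ≡⟨ +-identityʳ _ ⟨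
    f ! * 1 + ∑ (L \\ j) (λ i → lastCount j V f (L \\ i)) + 0       ∎
    where
    open ≤-Reasoning
    L\j≡f = length-\\≡ !L eq j∈L
    each : ∀ {i} → i ∈ L \\ j → f ! ≤ lastCount j V f (L \\ i)
    each {i} i∈ with i∈L , i≢j ← ∈-\\⁻ L i∈ = begin
      f !                                                  ≤⟨ lastCount-≥ f j∉V (unique-\\ !L) (length-\\≡ !L eq i∈L) (∈-\\⁺ j∈L (≢-sym i≢j)) ⟩
      suc (meet V (L \\ i)) * lastCount j V f (L \\ i)     ≡⟨ cong (λ m → suc m * lastCount j V f (L \\ i)) (trans (meet-\\-∉ L (λ i∈V → meet≡0⇒∉ {V} v≡ i∈V i∈L)) v≡) ⟩
      1 * lastCount j V f (L \\ i)                         ≡⟨ *-identityˡ _ ⟩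
      lastCount j V f (L \\ i)                             ∎
  -- Here `j` may not come first. Induction gives the share `1 / (w + 1)` for a first variable in
  -- `V` and `1 / (w + 2)` for any other; multiplying by `(w + 1) * (w + 2)` clears both
  -- denominators. The surplus of the `w + 1` variables in `V` makes up for the missing term of `j`.
  ... | suc w = *-cancelˡ-≤ (suc w) (begin
    suc w * (suc f * f !)                                             ≡⟨ split w f (f !) ⟩
    f * (suc w * f !) + suc w * f !                                   ≡⟨ cong₂ _+_ (cong (_* (suc w * f !)) (sym L\j≡f)) (cong (_* f !) (sym Vj)) ⟩
    length (L \\ j) * (suc w * f !) + meet V (L \\ j) * f !           ≡⟨ cong₂ _+_ (∑-const (L \\ j) _) (∑-const (filter (_∈? V) (L \\ j)) _) ⟨
    ∑ (L \\ j) (λ _ → suc w * f !) + ∑ (filter (_∈? V) (L \\ j)) (λ _ → f !)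
                                                                      ≡⟨ cong (_+ ∑ (filter (_∈? V) (L \\ j)) (λ _ → f !)) (∑-filter-split (_∈? V) (L \\ j) _) ⟩
    ∑ in-V (λ _ → suc w * f !) + ∑ out-V (λ _ → suc w * f !) + ∑ in-V (λ _ → f !)
                                                                      ≡⟨ swap₂₃ (∑ in-V (λ _ → suc w * f !)) _ _ ⟩
    ∑ in-V (λ _ → suc w * f !) + ∑ in-V (λ _ → f !) + ∑ out-V (λ _ → suc w * f !)
                                                                      ≡⟨ cong (_+ ∑ out-V (λ _ → suc w * f !)) (∑-+ in-V _ _) ⟨
    ∑ in-V (λ _ → suc w * f ! + f !) + ∑ out-V (λ _ → suc w * f !)    ≤⟨ +-mono-≤ (∑-mono in-V each-in) (∑-mono out-V each-out) ⟩
    ∑ in-V (λ i → suc w * (suc (suc w) * C i)) + ∑ out-V (λ i → suc w * (suc (suc w) * C i))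
                                                                      ≡⟨ ∑-filter-split (_∈? V) (L \\ j) _ ⟨
    ∑ (L \\ j) (λ i → suc w * (suc (suc w) * C i))                    ≡⟨ trans (∑-* (L \\ j) (suc w) _) (cong (suc w *_) (∑-* (L \\ j) (suc (suc w)) C)) ⟩
    suc w * (suc (suc w) * ∑ (L \\ j) C)                              ≡⟨ cong (λ m → suc w * (suc (suc w) * (m + ∑ (L \\ j) C))) (sym (*-zeroʳ (f !))) ⟩
    suc w * (suc (suc w) * (f ! * 0 + ∑ (L \\ j) C))                  ∎)
    where
    open ≤-Reasoning
    C : Fin n → ℕ
    C i = lastCount j V f (L \\ i)
    in-V out-V : Variables
    in-V  = filter (_∈? V) (L \\ j)
    out-V = filter (¬? ∘ (_∈? V)) (L \\ j)
    L\j≡f = length-\\≡ !L eq j∈L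
    Vj : meet V (L \\ j) ≡ suc w
    Vj = trans (meet-\\-∉ L j∉V) v≡
    split : ∀ w f p → suc w * (suc f * p) ≡ f * (suc w * p) + suc w * p
    split = solve-∀
    swap₂₃ : ∀ a b c → a + b + c ≡ a + c + b
    swap₂₃ = solve-∀
    IH : ∀ {i} → i ∈ L \\ j → f ! ≤ suc (meet V (L \\ i)) * C i
    IH i∈ with i∈L , i≢j ← ∈-\\⁻ L i∈ =
      lastCount-≥ f j∉V (unique-\\ !L) (length-\\≡ !L eq i∈L) (∈-\\⁺ j∈L (≢-sym i≢j))
    each-in : ∀ {i} → i ∈ in-V → suc w * f ! + f ! ≤ suc w * (suc (suc w) * C i)
    each-in {i} i∈ with i∈L\j , i∈V ← ∈-filter⁻ (_∈? V) {xs = L \\ j} i∈ = begin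
      suc w * f ! + f !              ≡⟨ +-comm (suc w * f !) (f !) ⟩
      suc (suc w) * f !              ≤⟨ *-monoʳ-≤ (suc (suc w)) (IH i∈L\j) ⟩
      suc (suc w) * (suc (meet V (L \\ i)) * C i)
                                     ≡⟨ cong (λ m → suc (suc w) * (m * C i)) (trans (meet-\\-∈ !L (proj₁ (∈-\\⁻ L i∈L\j)) i∈V) v≡) ⟩
      suc (suc w) * (suc w * C i)    ≡⟨ comm₁₂ (suc (suc w)) (suc w) (C i) ⟩
      suc w * (suc (suc w) * C i)    ∎
      where
      comm₁₂ : ∀ a b c → a * (b * c) ≡ b * (a * c)
      comm₁₂ = solve-∀
    each-out : ∀ {i} → i ∈ out-V → suc w * f ! ≤ suc w * (suc (suc w) * C i)
    each-out {i} i∈ with i∈L\j , i∉V ← ∈-filter⁻ (¬? ∘ (_∈? V)) {xs = L \\ j} i∈ =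
      *-monoʳ-≤ (suc w) (≤-trans (IH i∈L\j)
        (≤-reflexive (cong (λ m → suc m * C i) (trans (meet-\\-∉ L i∉V) v≡))))

  -- The bits saved by the code along `π`: one for each `i` listed when nothing of `V i` remains.
  forcedCount : (Fin n → Variables) → Variables → Variables → ℕ
  forcedCount V L []      = 0
  forcedCount V L (i ∷ π) = δ (meet (V i) L) + forcedCount V (L \\ i) π

  -- Double counting of the pairs of an order and a variable forced in it. The induction exchanges
  -- the sums over the first variable `i` and a later variable `j`.
  ∑-forcedCount : ∀ V f {L} → Unique L → length L ≡ f →
                  ∑ (orders f L) (forcedCount V L) ≡ ∑ L (λ j → lastCount j (V j) f L)
  ∑-forcedCount V zero    {[]} !L eq = refl
  ∑-forcedCount V (suc f) {L} !L eq = begin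
    ∑ (orders (suc f) L) (forcedCount V L)
      ≡⟨ ∑-orders f L _ ⟩
    ∑ L (λ i → ∑ (orders f (L \\ i)) (λ π → δ (meet (V i) L) + forcedCount V (L \\ i) π))
      ≡⟨ ∑-cong L (λ {i} i∈L → trans (∑-+ (orders f (L \\ i)) _ _)
           (cong₂ _+_ (∑-orders-const f _ (unique-\\ !L) (length-\\≡ !L eq i∈L))
                      (∑-forcedCount V f (unique-\\ !L) (length-\\≡ !L eq i∈L)))) ⟩
    ∑ L (λ i → f ! * δ (meet (V i) L) + ∑ (L \\ i) (λ j → lastCount j (V j) f (L \\ i)))
      ≡⟨ ∑-+ L _ _ ⟩
    ∑ L (λ i → f ! * δ (meet (V i) L)) + ∑ L (λ i → ∑ (L \\ i) (λ j → lastCount j (V j) f (L \\ i)))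
      ≡⟨ cong (∑ L (λ i → f ! * δ (meet (V i) L)) +_) (∑∑-\\-swap L (λ i j → lastCount j (V j) f (L \\ i))) ⟩
    ∑ L (λ j → f ! * δ (meet (V j) L)) + ∑ L (λ j → ∑ (L \\ j) (λ i → lastCount j (V j) f (L \\ i)))
      ≡⟨ ∑-+ L _ _ ⟨
    ∑ L (λ j → lastCount j (V j) (suc f) L) ∎
    where open ≡-Reasoning

  -- Linearity of expectation: in a random order each `j` is forced with probability at least
  -- `1 / k`, so at least `f / k` variables are forced on average.
  average-forcedCount : ∀ {V k f L} → (∀ j → j ∉ V j) → (∀ {j} → j ∈ L → meet (V j) L < k) →
                        Unique L → length L ≡ f →
                        f * f ! ≤ k * ∑ (orders f L) (forcedCount V L)
  average-forcedCount {V} {k} {f} {L} irrefl narrow !L eq = begin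
    f * f !                                ≡⟨ cong (_* f !) eq ⟨
    length L * f !                         ≡⟨ ∑-const L (f !) ⟨
    ∑ L (λ _ → f !)                        ≤⟨ ∑-mono L (λ {j} j∈L → ≤-trans (lastCount-≥ f (irrefl j) !L eq j∈L) (*-monoˡ-≤ _ (narrow j∈L))) ⟩
    ∑ L (λ j → k * lastCount j (V j) f L)  ≡⟨ ∑-* L k _ ⟩
    k * ∑ L (λ j → lastCount j (V j) f L)  ≡⟨ cong (k *_) (∑-forcedCount V f !L eq) ⟨
    k * ∑ (orders f L) (forcedCount V L)   ∎
    where open ≤-Reasoning

  -- The code and its length

  lookup-injective : ∀ {x y : Assignment n} → (∀ i → lookup x i ≡ lookup y i) → x ≡ y
  lookup-injective {x} {y} h = trans (sym (tabulate∘lookup x)) (trans (tabulate-cong h) (tabulate∘lookup y))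

  AgreeOff : Variables → List (Assignment n) → Set
  AgreeOff L S = ∀ {x y j} → x ∈ S → y ∈ S → j ∉ L → lookup x j ≡ lookup y j

  -- The set depends on `x` alone, while `y` is any member of `S`, whatever `V y i` is. The values
  -- on `V x i` therefore suffice for decoding the value at `i`.
  Determined : (Assignment n → Fin n → Variables) → Variables → List (Assignment n) → Set
  Determined V L S = ∀ {x y i} → x ∈ S → y ∈ S → i ∈ L →
    (∀ {j} → j ∈ V x i → lookup x j ≡ lookup y j) → lookup x i ≡ lookup y i

  module _ (V : Assignment n → Fin n → Variables) where

    -- Kraft's inequality for the code that lists the values of x in the order π
    -- and omits those determined by the preceding ones.
    kraft : ∀ {L π S} → Order L π → Unique S → Determined V L S → AgreeOff L S →
            ∑ S (λ x → 2 ^ forcedCount (V x) L π) ≤ 2 ^ length π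
    kraft {S = []}        []  !S det agree = z≤n
    kraft {S = _ ∷ []}    []  !S det agree = ≤-refl
    kraft {S = x ∷ y ∷ _} [] ((x≢y ∷ _) ∷ _) det agree =
      contradiction (lookup-injective (λ i → agree {x} {y} {i} (here refl) (there (here refl)) λ ())) x≢y
    kraft {L} {i ∷ π} {S} (step i∈L o) !S det agree
      with any? (λ x → meet (V x i) L ≟ 0) S
    -- One `z` with `V z i` fully listed settles `i` for all of `S`: its members agree off `L`,
    -- hence on `V z i`, hence with `z` at `i`. The absence of branching pays for the bit that each
    -- member may save.
    ... | yes some with z , z∈S , v≡0 ← find some = begin
      ∑ S (λ x → 2 ^ (δ (meet (V x i) L) + F x))  ≤⟨ ∑-mono S (λ {x} _ → ^-monoʳ-≤ 2 (+-monoˡ-≤ (F x) (δ≤1 (meet (V x i) L)))) ⟩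
      ∑ S (λ x → 2 * 2 ^ F x)                     ≡⟨ ∑-* S 2 _ ⟩
      2 * ∑ S (λ x → 2 ^ F x)                     ≤⟨ *-monoʳ-≤ 2 (kraft o !S (λ x∈ y∈ j∈ → det x∈ y∈ (proj₁ (∈-\\⁻ L j∈))) agree′) ⟩
      2 * 2 ^ length π                            ∎
      where
      open ≤-Reasoning
      F : Assignment n → ℕ
      F x = forcedCount (V x) (L \\ i) π
      δ≤1 : ∀ m → δ m ≤ 1
      δ≤1 zero    = ≤-refl
      δ≤1 (suc _) = z≤n
      same : ∀ {y} → y ∈ S → lookup z i ≡ lookup y i
      same y∈S = det z∈S y∈S i∈L (λ j∈V → agree z∈S y∈S (meet≡0⇒∉ {V z i} v≡0 j∈V))
      agree′ : AgreeOff (L \\ i) S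
      agree′ {j = j} x∈ y∈ j∉ with j ≟ᶠ i
      ... | yes refl = trans (sym (same x∈)) (same y∈)
      ... | no j≢i   = agree x∈ y∈ (λ j∈L → j∉ (∈-\\⁺ j∈L j≢i))
    -- No member saves a bit at `i`, so there is room to split `S` by the value at `i`.
    ... | no none = begin
      ∑ S (λ x → 2 ^ (δ (meet (V x i) L) + F x))  ≡⟨ ∑-cong S (λ {x} x∈S → cong (λ m → 2 ^ (m + F x)) (δ≡0 _ (λ v≡0 → none (lose x∈S v≡0)))) ⟩
      ∑ S (λ x → 2 ^ F x)                         ≡⟨ ∑-filter-split P? S _ ⟩
      ∑ S₁ (λ x → 2 ^ F x) + ∑ S₀ (λ x → 2 ^ F x) ≤⟨ +-mono-≤ (half P? λ p q → trans p (sym q)) (half (¬? ∘ P?) ≢true) ⟩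
      2 ^ length π + 2 ^ length π                 ≡⟨ cong (2 ^ length π +_) (+-identityʳ _) ⟨
      2 * 2 ^ length π                            ∎
      where
      open ≤-Reasoning
      F : Assignment n → ℕ
      F x = forcedCount (V x) (L \\ i) π
      P? : Decidable (λ (x : Assignment n) → lookup x i ≡ true)
      P? x = lookup x i ≟ᵇ true
      S₁ S₀ : List (Assignment n)
      S₁ = filter P? S
      S₀ = filter (¬? ∘ P?) S
      δ≡0 : ∀ m → m ≢ 0 → δ m ≡ 0
      δ≡0 zero    m≢0 = contradiction refl m≢0
      δ≡0 (suc _) _   = refl
      ≢true : ∀ {b c} → b ≢ true → c ≢ true → b ≡ c
      ≢true {true}          p q = contradiction refl p
      ≢true {false} {true}  p q = contradiction refl q
      ≢true {false} {false} p q = refl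
      half : ∀ {Q : Pred (Assignment n) 0ℓ} (Q? : Decidable Q) →
             (∀ {x y} → Q x → Q y → lookup x i ≡ lookup y i) →
             ∑ (filter Q? S) (λ x → 2 ^ F x) ≤ 2 ^ length π
      half Q? const = kraft o (Unique.filter⁺ Q? !S)
        (λ x∈ y∈ j∈ → det (proj₁ (∈-filter⁻ Q? x∈)) (proj₁ (∈-filter⁻ Q? y∈)) (proj₁ (∈-\\⁻ L j∈))) agree′
        where
        agree′ : AgreeOff (L \\ i) (filter Q? S)
        agree′ {j = j} x∈ y∈ j∉ with j ≟ᶠ i | ∈-filter⁻ Q? {xs = S} x∈ | ∈-filter⁻ Q? {xs = S} y∈
        ... | yes refl | _ , Qx   | _ , Qy   = const Qx Qy
        ... | no j≢i   | x∈S , _  | y∈S , _  = agree x∈S y∈S (λ j∈L → j∉ (∈-\\⁺ j∈L j≢i))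

    -- The average over all orders is bounded below by convexity of 2 ^ t: with
    -- f = r + q k, it is at least the chord over [q , q + 1] at f / k.
    chord-bound : ∀ {k L S q r} .{{_ : NonZero k}} →
      (∀ x i → i ∉ V x i) → (∀ {x i} → x ∈ S → i ∈ L → meet (V x i) L < k) →
      Unique L → Unique S → Determined V L S → AgreeOff L S → length L ≡ r + q * k →
      length S * (2 ^ q * (k + r)) ≤ k * 2 ^ length L
    chord-bound {k} {L} {S} {q} {r} irrefl narrow !L !S det agree f≡ =
      *-cancelˡ-≤ P {{f !≢0}} (begin
      P * (length S * (2 ^ q * (k + r)))          ≡⟨ comm₁₂ P (length S) _ ⟩
      length S * (P * (2 ^ q * (k + r)))          ≡⟨ ∑-const S _ ⟨
      ∑ S (λ _ → P * (2 ^ q * (k + r)))           ≤⟨ ∑-mono S each ⟩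
      ∑ S (λ x → k * ∑ Π (λ π → 2 ^ F x π))       ≡⟨ ∑-* S k _ ⟩
      k * ∑ S (λ x → ∑ Π (λ π → 2 ^ F x π))       ≡⟨ cong (k *_) (∑-swap S Π _) ⟩
      k * ∑ Π (λ π → ∑ S (λ x → 2 ^ F x π))       ≤⟨ *-monoʳ-≤ k (∑-mono Π (λ π∈ → let o , l = All.lookup sound π∈ in
                                                       ≤-trans (kraft o !S det agree) (≤-reflexive (cong (2 ^_) l)))) ⟩
      k * ∑ Π (λ _ → 2 ^ f)                       ≡⟨ cong (k *_) (∑-orders-const f (2 ^ f) !L refl) ⟩
      k * (P * 2 ^ f)                             ≡⟨ comm₁₂ k P _ ⟩
      P * (k * 2 ^ f)                             ∎)
      where
      open ≤-Reasoning
      f = length L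
      P = f !
      Π = orders f L
      F : Assignment n → Variables → ℕ
      F x = forcedCount (V x) L
      sound = orders-sound f !L refl
      comm₁₂ : ∀ a b c → a * (b * c) ≡ b * (a * c)
      comm₁₂ = solve-∀
      expand : ∀ P Q k r q → P * (Q * (k + r)) + k * (P * (q * Q)) ≡ Q * (k * P + (r + q * k) * P)
      expand = solve-∀
      factor : ∀ Q k P T → Q * (k * P + k * T) ≡ k * (Q * (P + T))
      factor = solve-∀
      -- Times `k`, the chord `2 ^ q * (1 + t - q)` at `t = (r + q * k) / k` is `2 ^ q * (k + r)`.
      -- Its negative term is added to both sides to avoid subtraction.
      each : ∀ {x} → x ∈ S → P * (2 ^ q * (k + r)) ≤ k * ∑ Π (λ π → 2 ^ F x π)
      each {x} x∈S = +-cancelʳ-≤ (k * (P * (q * 2 ^ q))) _ _ (begin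
        P * (2 ^ q * (k + r)) + k * (P * (q * 2 ^ q))  ≡⟨ expand P (2 ^ q) k r q ⟩
        2 ^ q * (k * P + (r + q * k) * P)              ≡⟨ cong (λ m → 2 ^ q * (k * P + m * P)) f≡ ⟨
        2 ^ q * (k * P + f * P)                        ≤⟨ *-monoʳ-≤ (2 ^ q) (+-monoʳ-≤ (k * P) (average-forcedCount {V x} {k} (irrefl x) (narrow x∈S) !L refl)) ⟩
        2 ^ q * (k * P + k * ∑ Π (F x))                ≡⟨ factor (2 ^ q) k P _ ⟩
        k * (2 ^ q * (P + ∑ Π (F x)))                  ≡⟨ cong (λ m → k * (2 ^ q * (m + ∑ Π (F x)))) (trans (∑-orders-const f 1 !L refl) (*-identityʳ P)) ⟨
        k * (2 ^ q * (∑ Π (λ _ → 1) + ∑ Π (F x)))      ≡⟨ cong (λ m → k * (2 ^ q * m)) (∑-+ Π _ _) ⟨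
        k * (2 ^ q * ∑ Π (λ π → suc (F x π)))          ≡⟨ cong (k *_) (∑-* Π (2 ^ q) _) ⟨
        k * ∑ Π (λ π → 2 ^ q * suc (F x π))            ≤⟨ *-monoʳ-≤ k (∑-mono Π (λ {π} _ → chord q (F x π))) ⟩
        k * ∑ Π (λ π → 2 ^ F x π + q * 2 ^ q)          ≡⟨ cong (k *_) (∑-+ Π _ _) ⟩
        k * (∑ Π (λ π → 2 ^ F x π) + ∑ Π (λ _ → q * 2 ^ q))
                                                       ≡⟨ cong (λ m → k * (∑ Π (λ π → 2 ^ F x π) + m)) (∑-orders-const f _ !L refl) ⟩
        k * (∑ Π (λ π → 2 ^ F x π) + P * (q * 2 ^ q))  ≡⟨ *-distribˡ-+ k _ _ ⟩
        k * ∑ Π (λ π → 2 ^ F x π) + k * (P * (q * 2 ^ q)) ∎)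

    -- In the `k`-th power of `chord-bound`, `(k + r) ^ k` is at least `2 ^ r * k ^ k`, as the chord
    -- lies above the exponential between its end points. The powers of two on the left then combine
    -- to `2 ^ length L`, which cancels one of the `k` copies on the right.
    determined-bound : ∀ k′ {L S} → let k = suc k′ in
      (∀ x i → i ∉ V x i) → (∀ {x i} → x ∈ S → i ∈ L → meet (V x i) L < k) →
      Unique L → Unique S → Determined V L S → AgreeOff L S →
      length S ^ k ≤ 2 ^ (length L * k′)
    determined-bound k′ {L} {S} irrefl narrow !L !S det agree =
      *-cancelʳ-≤ _ _ (2 ^ f * k ^ k) {{m*n≢0 _ _ {{m^n≢0 2 f}} {{m^n≢0 k k}}}} (begin
      N ^ k * (2 ^ f * k ^ k)                ≡⟨ cong (λ m → N ^ k * (m * k ^ k)) 2^f≡ ⟩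
      N ^ k * (2 ^ (q * k) * 2 ^ r * k ^ k)  ≡⟨ cong (N ^ k *_) (*-assoc (2 ^ (q * k)) _ _) ⟩
      N ^ k * (2 ^ (q * k) * (2 ^ r * k ^ k)) ≤⟨ *-monoʳ-≤ (N ^ k) (*-monoʳ-≤ (2 ^ (q * k)) (2^r*k^k≤[k+r]^k k (<⇒≤ (m%n<n f k)))) ⟩
      N ^ k * (2 ^ (q * k) * (k + r) ^ k)    ≡⟨ cong (λ m → N ^ k * (m * (k + r) ^ k)) (^-*-assoc 2 q k) ⟨
      N ^ k * ((2 ^ q) ^ k * (k + r) ^ k)    ≡⟨ trans (^-distribʳ-* N _ k) (cong (N ^ k *_) (^-distribʳ-* (2 ^ q) (k + r) k)) ⟨
      (N * (2 ^ q * (k + r))) ^ k            ≤⟨ ^-monoˡ-≤ k (chord-bound {k} {q = q} {r} irrefl narrow !L !S det agree f≡) ⟩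
      (k * 2 ^ f) ^ k                        ≡⟨ trans (^-distribʳ-* k (2 ^ f) k) (cong (k ^ k *_) (^-*-assoc 2 f k)) ⟩
      k ^ k * 2 ^ (f * k)                    ≡⟨ cong (λ m → k ^ k * 2 ^ m) (trans (*-suc f k′) (+-comm f _)) ⟩
      k ^ k * 2 ^ (f * k′ + f)               ≡⟨ cong (k ^ k *_) (^-distribˡ-+-* 2 (f * k′) f) ⟩
      k ^ k * (2 ^ (f * k′) * 2 ^ f)         ≡⟨ rotate (k ^ k) (2 ^ (f * k′)) (2 ^ f) ⟩
      2 ^ (f * k′) * (2 ^ f * k ^ k)         ∎)
      where
      open ≤-Reasoning
      k = suc k′
      N = length S
      f = length L
      q = f / k
      r = f % k
      f≡ : f ≡ r + q * k
      f≡ = m≡m%n+[m/n]*n f k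
      2^f≡ : 2 ^ f ≡ 2 ^ (q * k) * 2 ^ r
      2^f≡ = trans (cong (2 ^_) (trans f≡ (+-comm r _))) (^-distribˡ-+-* 2 (q * k) r)
      rotate : ∀ a b c → a * (b * c) ≡ b * (c * a)
      rotate = solve-∀

-- Clauses and windows

module _ {a} {A : Set a} (p : A → Bool) where

  any-true : ∀ xs → any p xs ≡ true → Any (λ x → p x ≡ true) xs
  any-true (x ∷ xs) eq with p x in px
  ... | true  = here px
  ... | false = there (any-true xs eq)

  any-false : ∀ xs → any p xs ≡ false → All (λ x → p x ≡ false) xs
  any-false []       eq = []
  any-false (x ∷ xs) eq with p x in px
  ... | false = px ∷ any-false xs eq

  all-true : ∀ xs → all p xs ≡ true → All (λ x → p x ≡ true) xs
  all-true []       eq = []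
  all-true (x ∷ xs) eq with p x in px
  ... | true = px ∷ all-true xs eq

module _ {n : ℕ} where
  open Removal (_≟ᶠ_ {n})
  open DecMembership (_≟ᶠ_ {n}) using (_∈?_)

  evalLit-cong : ∀ {x y : Assignment n} {j} b → lookup x j ≡ lookup y j → evalLit x (j , b) ≡ evalLit y (j , b)
  evalLit-cong true  eq = eq
  evalLit-cong false eq = cong not eq

  evalLit-injective : ∀ {x y : Assignment n} {j} b → evalLit x (j , b) ≡ evalLit y (j , b) → lookup x j ≡ lookup y j
  evalLit-injective true  eq = eq
  evalLit-injective false eq = not-injective eq

  evalLit-flip : ∀ (x : Assignment n) i b → evalLit (flip x i) (i , b) ≡ not (evalLit x (i , b))
  evalLit-flip x i true  = lookup∘updateAt i x
  evalLit-flip x i false = cong not (lookup∘updateAt i x)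

  evalLit-flip′ : ∀ (x : Assignment n) {i j} b → j ≢ i → evalLit (flip x i) (j , b) ≡ evalLit x (j , b)
  evalLit-flip′ x {i} {j} b j≢i = evalLit-cong b (lookup∘updateAt′ j i j≢i x)

  firstFalse : CNF n → Assignment n → Clause n
  -- A default, reached only if `y` satisfies every clause.
  firstFalse []      y = []
  firstFalse (c ∷ φ) y = if evalClause y c then firstFalse φ y else c

  firstFalse-spec : ∀ φ {y} → evalCNF φ y ≡ false →
                    firstFalse φ y ∈ φ × All (λ l → evalLit y l ≡ false) (firstFalse φ y)
  firstFalse-spec (c ∷ φ) {y} eq with evalClause y c in c≡
  ... | true  = let c∈φ , allFalse = firstFalse-spec φ eq in there c∈φ , allFalse
  ... | false = here refl , any-false (evalLit y) c c≡

  record Isolating (φ : CNF n) (L : Variables) (S : List (Assignment n)) : Set where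
    field
      !L       : Unique L
      !S       : Unique S
      solves   : ∀ {x} → x ∈ S → evalCNF φ x ≡ true
      isolated : ∀ {x i} → x ∈ S → i ∈ L → evalCNF φ (flip x i) ≡ false
      agree    : AgreeOff L S

  module Window (k : ℕ) (L : List (Fin n)) where

    -- Filtering `L`, and not the clause, makes the window a sublist of `L`, so that it can be
    -- counted inside `L`.
    occurring : Clause n → Variables
    occurring c = filter (_∈? map proj₁ c) L

    window : Clause n → Variables
    window c = take k (occurring c)

    window⊆L : ∀ c → window c Sublist.⊆ L
    window⊆L c = Sublist.⊆-trans (Sublist.take-⊆ k _) (Sublist.filter-⊆ (_∈? map proj₁ c) L)

    window-occurs : ∀ {c j} → j ∈ window c → ∃ λ b → (j , b) ∈ c
    window-occurs {c} j∈ with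
      (j , b) , jb∈c , refl ← ∈-map⁻ proj₁ (proj₂ (∈-filter⁻ (_∈? map proj₁ c) {xs = L}
        (Sublist.Any-resp-⊆ (Sublist.take-⊆ k _) j∈))) = b , jb∈c

    length-window : ∀ c → length (window c) ≤ k
    length-window c = ≤-trans (≤-reflexive (length-take k _)) (m⊓n≤m k _)

    Falsifies : Assignment n → Clause n → Set
    Falsifies x c = All (λ l → proj₁ l ∈ window c → evalLit x l ≡ false) c

    -- The first condition makes the window full, so that fixing its variables takes `k` of them out
    -- of `L`.
    Bad : Clause n → Assignment n → Set
    Bad c x = k ≤ length (occurring c) × Falsifies x c

    bad? : ∀ c → Decidable (Bad c)
    bad? c x = (k ≤? length (occurring c)) ×-dec
               All.all? (λ l → (proj₁ l ∈? window c) →-dec (evalLit x l ≟ᵇ false)) c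

    outside : Clause n → Variables
    outside c = filter (λ j → ¬? (j ∈? window c)) L

    length-outside : ∀ c → k ≤ length (occurring c) → k + length (outside c) ≤ length L
    length-outside c wide = begin
      k + length (outside c)                                      ≡⟨ cong (_+ length (outside c)) (trans (length-take k _) (m≤n⇒m⊓n≡m wide)) ⟨
      length W + length (outside c)                               ≡⟨ cong (λ ws → length ws + length (outside c)) (filter-all (_∈? W) (All.tabulate (λ j∈ → j∈))) ⟨
      length (filter (_∈? W) W) + length (outside c)              ≤⟨ +-monoˡ-≤ _ (Sublist.length-mono-≤ (Sublist.filter⁺ (_∈? W) (_∈? W) (λ { refl p → p }) (window⊆L c))) ⟩
      length (filter (_∈? W) L) + length (outside c)              ≡⟨ length-filter-split (_∈? W) L ⟩
      length L                                                    ∎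
      where
      open ≤-Reasoning
      W = window c

    -- All members that are bad for `c` falsify the same literals on the window, and a false literal
    -- fixes the value of its variable. Agreement thus extends to the window.
    restrict-bad : ∀ {φ S} c → Isolating φ L S → Isolating φ (outside c) (filter (bad? c) S)
    restrict-bad {φ} {S} c I = record
      { !L       = Unique.filter⁺ _ !L
      ; !S       = Unique.filter⁺ (bad? c) !S
      ; solves   = solves ∘ proj₁ ∘ unfilter
      ; isolated = λ x∈ i∈ → isolated (proj₁ (unfilter x∈)) (proj₁ (∈-filter⁻ (λ j → ¬? (j ∈? window c)) i∈))
      ; agree    = agree′
      }
      where
      open Isolating I
      unfilter : ∀ {x} → x ∈ filter (bad? c) S → x ∈ S × Bad c x
      unfilter = ∈-filter⁻ (bad? c) {xs = S}
      agree′ : AgreeOff (outside c) (filter (bad? c) S)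
      agree′ {j = j} x∈ y∈ j∉ with j ∈? window c | unfilter x∈ | unfilter y∈
      ... | no j∉W  | x∈S , _        | y∈S , _       =
        agree x∈S y∈S (λ j∈L → j∉ (∈-filter⁺ (λ j → ¬? (j ∈? window c)) j∈L j∉W))
      ... | yes j∈W | _ , _ , xFalse | _ , _ , yFalse with b , jb∈c ← window-occurs j∈W =
        evalLit-injective b (trans (All.lookup xFalse jb∈c j∈W) (sym (All.lookup yFalse jb∈c j∈W)))

    -- Solutions that satisfy every window

    module _ {φ : CNF n} {S : List (Assignment n)} (I : Isolating φ L S) where
      open Isolating I

      someBad? : Decidable (λ x → Any (λ c → Bad c x) φ)
      someBad? x = any? (λ c → bad? c x) φ

      good : List (Assignment n)
      good = filter (¬? ∘ someBad?) S

      good⊆S : ∀ {x} → x ∈ good → x ∈ S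
      good⊆S = proj₁ ∘ ∈-filter⁻ (¬? ∘ someBad?) {xs = S}

      -- A full window that is not falsified has a true literal. A window that is not full contains
      -- all variables of the clause in `L`, so any true literal will do; its variable may lie off
      -- `L`, where `S` agrees.
      window-satisfied : ∀ {x c} → x ∈ good → c ∈ φ →
        ∃ λ l → l ∈ c × evalLit x l ≡ true × (proj₁ l ∈ L → proj₁ l ∈ window c)
      window-satisfied {x} {c} x∈ c∈φ with k ≤? length (occurring c)
      ... | yes wide = let l , l∈c , ¬false = find (All.¬All⇒Any¬ falsified? c
                                (λ f → proj₂ (∈-filter⁻ (¬? ∘ someBad?) {xs = S} x∈) (lose c∈φ (wide , f))))
                       in l , l∈c , true-in-window l ¬false
        where
        falsified? : Decidable (λ l → proj₁ l ∈ window c → evalLit x l ≡ false)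
        falsified? l = (proj₁ l ∈? window c) →-dec (evalLit x l ≟ᵇ false)
        true-in-window : ∀ l → ¬ (proj₁ l ∈ window c → evalLit x l ≡ false) →
                         evalLit x l ≡ true × (proj₁ l ∈ L → proj₁ l ∈ window c)
        true-in-window l ¬false with evalLit x l | proj₁ l ∈? window c
        ... | false | _       = contradiction (λ _ → refl) ¬false
        ... | true  | no j∉W  = contradiction (λ j∈W → contradiction j∈W j∉W) ¬false
        ... | true  | yes j∈W = refl , λ _ → j∈W
      ... | no narrow with l , l∈c , true≡ ← find (any-true (evalLit x) c
                             (All.lookup (all-true (evalClause x) φ (solves (good⊆S x∈))) c∈φ)) =
        l , l∈c , true≡ , λ j∈L → subst (proj₁ l ∈_) (sym (take-all k (occurring c) (<⇒≤ (≰⇒> narrow))))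
                                    (∈-filter⁺ (_∈? map proj₁ c) j∈L (∈-map⁺ proj₁ l∈c))

      -- For good `x` and `i` in `L`, flipping `i` falsifies this clause, so its literals true at
      -- `x` are exactly those on `i`.
      critical : Assignment n → Fin n → Clause n
      critical x i = firstFalse φ (flip x i)

      V : Assignment n → Fin n → Variables
      V x i = window (critical x i) \\ i

      critical∈φ : ∀ {x i} → x ∈ good → i ∈ L → critical x i ∈ φ
      critical∈φ x∈ i∈L = proj₁ (firstFalse-spec φ (isolated (good⊆S x∈) i∈L))

      critical-false : ∀ {x i j b} → x ∈ good → i ∈ L → (j , b) ∈ critical x i → j ≢ i →
                       evalLit x (j , b) ≡ false
      critical-false {x} {i} {b = b} x∈ i∈L l∈c j≢i =
        trans (sym (evalLit-flip′ x b j≢i))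
              (All.lookup (proj₂ (firstFalse-spec φ (isolated (good⊆S x∈) i∈L))) l∈c)

      critical-true : ∀ {x i b} → x ∈ good → i ∈ L → (i , b) ∈ critical x i → evalLit x (i , b) ≡ true
      critical-true {x} {i} {b} x∈ i∈L l∈c = not-injective
        (trans (sym (evalLit-flip x i b))
               (All.lookup (proj₂ (firstFalse-spec φ (isolated (good⊆S x∈) i∈L))) l∈c))

      -- The critical clause of `x` has a literal true at `y` in its window or off `L`. If it is on
      -- `i`, it is true at `x` as well. If it is on another `j`, it is false at `x`, although `x`
      -- and `y` agree at `j`.
      V-determined : Determined V L good
      V-determined {x} {y} {i} x∈ y∈ i∈L same
        with (j , b) , l∈c , y-true , in-window ← window-satisfied y∈ (critical∈φ x∈ i∈L)
        with j ≟ᶠ i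
      ... | yes refl = evalLit-injective b (trans (critical-true x∈ i∈L l∈c) (sym y-true))
      ... | no j≢i = contradiction
        (trans (sym (critical-false x∈ i∈L l∈c j≢i)) (trans (evalLit-cong b same-j) y-true)) λ ()
        where
        same-j : lookup x j ≡ lookup y j
        same-j with j ∈? L
        ... | yes j∈L = same (∈-\\⁺ (in-window j∈L) j≢i)
        ... | no j∉L  = agree (good⊆S x∈) (good⊆S y∈) j∉L

      -- The literal that `window-satisfied` gives for `x` itself can only be on `i`. Removing `i`
      -- therefore shrinks the window below `k`, which `V-narrow` needs.
      i∈window : ∀ {x i} → x ∈ good → i ∈ L → i ∈ window (critical x i)
      i∈window {x} {i} x∈ i∈L
        with (j , b) , l∈c , x-true , in-window ← window-satisfied x∈ (critical∈φ x∈ i∈L)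
        with j ≟ᶠ i
      ... | yes refl = in-window i∈L
      ... | no j≢i with () ← trans (sym (critical-false x∈ i∈L l∈c j≢i)) x-true

      V-narrow : ∀ {x i} → x ∈ good → i ∈ L → meet (V x i) L < k
      V-narrow {x} {i} x∈ i∈L = begin-strict
        meet (V x i) L                ≤⟨ Unique-⊆⇒length-≤ (Unique.filter⁺ (_∈? V x i) !L) (proj₂ ∘ ∈-filter⁻ (_∈? V x i) {xs = L}) ⟩
        length (V x i)                <⟨ length-\\-< (i∈window x∈ i∈L) ⟩
        length (window (critical x i)) ≤⟨ length-window (critical x i) ⟩
        k                             ∎
        where open ≤-Reasoning

  good-bound : ∀ k′ {φ L S} (I : Isolating φ L S) →
               length (Window.good (suc k′) L I) ^ suc k′ ≤ 2 ^ (length L * k′)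
  good-bound k′ {L = L} I = determined-bound (V I) k′
    (λ x i i∈V → proj₂ (∈-\\⁻ (window (critical I x i)) i∈V) refl) (V-narrow I)
    !L (Unique.filter⁺ _ !S) (V-determined I)
    (λ x∈ y∈ → agree (good⊆S I x∈) (good⊆S I y∈))
    where
    open Isolating I
    open Window (suc k′) L

-- Induction on the number of variables

common-bound : ∀ {a} {A : Set a} k {X} m xs (t : A → ℕ) → m ^ k ≤ X → (∀ {x} → x ∈ xs → t x ^ k ≤ X) →
               ∃ λ M → M ^ k ≤ X × m ≤ M × (∀ {x} → x ∈ xs → t x ≤ M)
common-bound k m []       t m≤ t≤ = m , m≤ , ≤-refl , λ ()
common-bound k m (x ∷ xs) t m≤ t≤
  with M , M≤ , m≤M , t≤M ← common-bound k m xs t m≤ (t≤ ∘ there)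
  -- The maximum of all parts is an integer that can replace the `k`-th root of `X`.
  with ≤-total (t x) M
... | inj₁ tx≤M = M , M≤ , m≤M , λ { (here refl) → tx≤M ; (there p) → t≤M p }
... | inj₂ M≤tx = t x , t≤ (here refl) , ≤-trans m≤M M≤tx ,
                  λ { (here refl) → ≤-refl ; (there p) → ≤-trans (t≤M p) M≤tx }

module _ {n : ℕ} (s : ℕ) (φ : CNF n) (φ≤ : length φ ≤ 2 ^ s) where

  private
    k = suc (suc s)

    -- The `k`-th power of `2 * 2 ^ (l - l / k)`, because `k - 1` is `suc s`.
    bound : ℕ → ℕ
    bound l = 2 ^ (l * suc s + k)

  -- The part `a` is at most half of `M`. Each of the at most `2 ^ s` clauses takes a fraction
  -- `1 / 2 ^ (s + 1)` of `M`, together at most the other half.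
  bound-from-parts : ∀ l N a (t : Clause n → ℕ) →
    (2 * a) ^ k ≤ bound l → (∀ c → (2 ^ suc s * t c) ^ k ≤ bound l) →
    N ≤ a + ∑ φ t → N ^ k ≤ bound l
  bound-from-parts l N a t a≤ t≤ N≤
    with M , M^k≤ , 2a≤M , t≤M ← common-bound k (2 * a) φ (λ c → 2 ^ suc s * t c) a≤ (λ {c} _ → t≤ c) =
    ≤-trans (^-monoˡ-≤ k (*-cancelˡ-≤ (2 ^ suc s) {{m^n≢0 2 (suc s)}} (begin
      2 ^ suc s * N                            ≤⟨ *-monoʳ-≤ (2 ^ suc s) N≤ ⟩
      2 ^ suc s * (a + ∑ φ t)                  ≡⟨ expand (2 ^ s) a (∑ φ t) ⟩
      2 ^ s * (2 * a) + 2 ^ suc s * ∑ φ t      ≡⟨ cong (2 ^ s * (2 * a) +_) (∑-* φ (2 ^ suc s) t) ⟨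
      2 ^ s * (2 * a) + ∑ φ (λ c → 2 ^ suc s * t c)
                                               ≤⟨ +-mono-≤ (*-monoʳ-≤ (2 ^ s) 2a≤M) (∑-mono φ t≤M) ⟩
      2 ^ s * M + ∑ φ (λ _ → M)                ≡⟨ cong (2 ^ s * M +_) (∑-const φ M) ⟩
      2 ^ s * M + length φ * M                 ≤⟨ +-monoʳ-≤ (2 ^ s * M) (*-monoˡ-≤ M φ≤) ⟩
      2 ^ s * M + 2 ^ s * M                    ≡⟨ double (2 ^ s) M ⟩
      2 ^ suc s * M                            ∎))) M^k≤
    where
    open ≤-Reasoning
    expand : ∀ p a b → 2 * p * (a + b) ≡ p * (2 * a) + 2 * p * b
    expand = solve-∀
    double : ∀ p m → p * m + p * m ≡ 2 * p * m
    double = solve-∀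

  isolating-bound : ∀ f {L S} → length L < f → Isolating φ L S → length S ^ k ≤ bound (length L)
  isolating-bound (suc f) {L} {S} (s≤s L≤f) I =
    bound-from-parts (length L) (length S) (length (good I)) (λ c → length (filter (bad? c) S)) good≤
    (λ c → [ wide≤ c , narrow≤ c ]′ (≤-<-connex k (length (occurring c)))) (begin
      length S                                                   ≡⟨ length-filter-split (someBad? I) S ⟨
      length (filter (someBad? I) S) + length (good I)           ≤⟨ +-monoˡ-≤ _ (union-bound bad? S φ) ⟩
      ∑ φ (λ c → length (filter (bad? c) S)) + length (good I)   ≡⟨ +-comm _ (length (good I)) ⟩
      length (good I) + ∑ φ (λ c → length (filter (bad? c) S))   ∎)
    where
    open ≤-Reasoning
    open Window k L
    good≤ : (2 * length (good I)) ^ k ≤ bound (length L)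
    good≤ = begin
      (2 * length (good I)) ^ k       ≡⟨ ^-distribʳ-* 2 (length (good I)) k ⟩
      2 ^ k * length (good I) ^ k     ≤⟨ *-monoʳ-≤ (2 ^ k) (good-bound (suc s) I) ⟩
      2 ^ k * 2 ^ (length L * suc s)  ≡⟨ ^-distribˡ-+-* 2 k _ ⟨
      2 ^ (k + length L * suc s)      ≡⟨ cong (2 ^_) (+-comm k _) ⟩
      bound (length L)                ∎
    exponent : ∀ k l p → p * k + (l * p + k) ≡ (k + l) * p + k
    exponent = solve-∀
    narrow≤ : ∀ c → length (occurring c) < k → (2 ^ suc s * length (filter (bad? c) S)) ^ k ≤ bound (length L)
    narrow≤ c narrow = begin
      (2 ^ suc s * length (filter (bad? c) S)) ^ k
        ≡⟨ cong (λ T → (2 ^ suc s * length T) ^ k) (filter-none (bad? c) {S} (All.tabulate (λ _ → <⇒≱ narrow ∘ proj₁))) ⟩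
      (2 ^ suc s * 0) ^ k  ≡⟨ cong (_^ k) (*-zeroʳ (2 ^ suc s)) ⟩
      0                    ≤⟨ z≤n ⟩
      bound (length L)     ∎
    -- The choice `k = s + 2` enters here: fixing `k` variables divides the `k`-th root of the bound
    -- by `2 ^ (k - 1) = 2 ^ (s + 1)`, which gives the share allowed to one clause.
    wide≤ : ∀ c → k ≤ length (occurring c) → (2 ^ suc s * length (filter (bad? c) S)) ^ k ≤ bound (length L)
    wide≤ c wide = begin
      (2 ^ suc s * length T) ^ k            ≡⟨ ^-distribʳ-* (2 ^ suc s) (length T) k ⟩
      (2 ^ suc s) ^ k * length T ^ k        ≤⟨ *-monoʳ-≤ ((2 ^ suc s) ^ k) (isolating-bound f (≤-trans shorter L≤f) (restrict-bad c I)) ⟩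
      (2 ^ suc s) ^ k * bound (length L′)   ≡⟨ cong (_* bound (length L′)) (^-*-assoc 2 (suc s) k) ⟩
      2 ^ (suc s * k) * bound (length L′)   ≡⟨ ^-distribˡ-+-* 2 (suc s * k) _ ⟨
      2 ^ (suc s * k + (length L′ * suc s + k))
                                            ≡⟨ cong (2 ^_) (exponent k (length L′) (suc s)) ⟩
      2 ^ ((k + length L′) * suc s + k)     ≤⟨ ^-monoʳ-≤ 2 (+-monoˡ-≤ k (*-monoˡ-≤ (suc s) (length-outside c wide))) ⟩
      bound (length L)                      ∎
      where
      T  = filter (bad? c) S
      L′ = outside c
      shorter : length L′ < length L
      shorter = ≤-trans (s≤s (m≤n+m (length L′) (suc s))) (length-outside c wide)

-- All isolated solutions of a formula

allAssignments-unique : ∀ n → Unique (allAssignments n)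
allAssignments-unique zero    = [] ∷ []
allAssignments-unique (suc n) = Unique.++⁺
  (Unique.map⁺ ∷-injectiveʳ (allAssignments-unique n))
  (Unique.map⁺ ∷-injectiveʳ (allAssignments-unique n))
  λ (p , q) → differ (∈-map⁻ (true ∷_) p) (∈-map⁻ (false ∷_) q)
  where
  differ : ∀ {v} → (∃ λ x → x ∈ allAssignments n × v ≡ true ∷ x) →
           ¬ (∃ λ y → y ∈ allAssignments n × v ≡ false ∷ y)
  differ (_ , _ , refl) (_ , _ , ())

-- Multiplying the exponent `n - n / (s + 2) + 1` by `s + 2` gives `n * (s + 1) + s + 2`.
theorem6p2 : (s n : ℕ) (φ : CNF n) → length φ ≤ 2 ^ s →
    numIsolated φ ^ (s + 2) ≤ 2 ^ (n * (s + 1) + s + 2)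
theorem6p2 s n φ φ≤ = begin
  numIsolated φ ^ (s + 2)                          ≡⟨ cong (numIsolated φ ^_) (+-comm s 2) ⟩
  numIsolated φ ^ (2 + s)                          ≤⟨ isolating-bound s φ φ≤ _ ≤-refl I ⟩
  2 ^ (length (allFin n) * suc s + suc (suc s))    ≡⟨ cong (λ l → 2 ^ (l * suc s + suc (suc s))) (length-tabulate {n = n} _) ⟩
  2 ^ (n * suc s + suc (suc s))                    ≡⟨ cong (2 ^_) (exponent n s) ⟩
  2 ^ (n * (s + 1) + s + 2)                        ∎
  where
  open ≤-Reasoning
  exponent : ∀ n s → n * suc s + suc (suc s) ≡ n * (s + 1) + s + 2
  exponent = solve-∀
  S = filter (isolated? φ) (allAssignments n)
  isolatedSolution : ∀ {x} → x ∈ S → IsolatedSolution φ x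
  isolatedSolution = proj₂ ∘ ∈-filter⁻ (isolated? φ) {xs = allAssignments n}
  -- The induction starts with every variable in `L`, where agreement off `L` is vacuous.
  I : Isolating φ (allFin n) S
  I = record
    { !L       = Unique.allFin⁺ n
    ; !S       = Unique.filter⁺ (isolated? φ) (allAssignments-unique n)
    ; solves   = proj₁ ∘ isolatedSolution
    ; isolated = λ x∈ _ → proj₂ (isolatedSolution x∈) _
    ; agree    = λ _ _ j∉ → contradiction (∈-allFin _) j∉
    }
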